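{- System $\mathsf{SKS}$ and system $\mathsf{SKSg}$ are strongly equivalent.
   Context: Structures: generated by $S ::= \mathsf f \mid \mathsf t \mid a \mid [S,\dots,S] \mid (S,\dots,S) \mid \bar S$ (non-empty lists), where $a$ ranges over atoms, $\mathsf f,\mathsf t$ are the units false and true, $[\cdot]$ is disjunction, $(\cdot)$ is conjunction, $\bar S$ is negation; the negation of an atom is again an atom. A context $S\{\ \}$ is a structure with one occurrence of a hole, not in the scope of a negation; $S\{R\}$ is the result of filling it with $R$; $S[R,T]$ abbreviates $S\{[R,T]\}$ and $S(R,T)$ abbreviates $S\{(R,T)\}$. Equivalent structures are not distinguished; equivalence is the smallest equivalence relation induced by: $[\vec R,[\vec T],\vec U]=[\vec R,\vec T,\vec U]$ and $(\vec R,(\vec T),\vec U)=(\vec R,\vec T,\vec U)$ (with $\vec R,\vec T,\vec U$ finite sequences, $\vec T$ non-empty); $[R,T]=[T,R]$, $(R,T)=(T,R)$; $(\mathsf f,\mathsf f)=\mathsf f$, $[\mathsf f,R]=R$, $[\mathsf t,\mathsf t]=\mathsf t$, $(\mathsf t,R)=R$; $\bar{\mathsf f}=\mathsf t$, $\bar{\mathsf t}=\mathsf f$, $\overline{[R,T]}=(\bar R,\bar T)$, $\overline{(R,T)}=[\bar R,\bar T]$, $\bar{\bar R}=R$; and closure: if $R=T$ then $S\{R\}=S\{T\}$ and $\bar R=\bar T$. A derivation in a system (set of inference rules) is a finite sequence of rule instances, read top-down, the conclusion of each being the premise of the next; it may consist of a single structure. Its premise is the topmost structure, its conclusion the bottommost.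 System $\mathsf{SKSg}$ has the rules (written $\frac{\text{premise}}{\text{conclusion}}$, for arbitrary structures $R,T,U$ and contexts $S\{\ \}$): $i{\downarrow}:\frac{S\{\mathsf t\}}{S[R,\bar R]}$, $i{\uparrow}:\frac{S(R,\bar R)}{S\{\mathsf f\}}$, $s:\frac{S([R,U],T)}{S[(R,T),U]}$, $w{\downarrow}:\frac{S\{\mathsf f\}}{S\{R\}}$, $w{\uparrow}:\frac{S\{R\}}{S\{\mathsf t\}}$, $c{\downarrow}:\frac{S[R,R]}{S\{R\}}$, $c{\uparrow}:\frac{S\{R\}}{S(R,R)}$. System $\mathsf{SKS}$ has the rules (for atoms $a$ and arbitrary structures $R,T,U,V$): $ai{\downarrow}:\frac{S\{\mathsf t\}}{S[a,\bar a]}$, $ai{\uparrow}:\frac{S(a,\bar a)}{S\{\mathsf f\}}$, $s:\frac{S([R,U],T)}{S[(R,T),U]}$, $m:\frac{S[(R,U),(T,V)]}{S([R,T],[U,V])}$, $aw{\downarrow}:\frac{S\{\mathsf f\}}{S\{a\}}$, $aw{\uparrow}:\frac{S\{a\}}{S\{\mathsf t\}}$, $ac{\downarrow}:\frac{S[a,a]}{S\{a\}}$, $ac{\uparrow}:\frac{S\{a\}}{S(a,a)}$. Two systems $\mathcal S,\mathcal S'$ are strongly equivalent if for every derivation in $\mathcal S$ with premise $T$ and conclusion $R$ there is a derivation in $\mathcal S'$ with premise $T$ and conclusion $R$, and vice versa. -}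

module Defs where

open import Algebra.Definitions using (Involutive)
open import Data.List.Base using (List; []; _∷_)
open import Data.List.NonEmpty.Base using (List⁺; _∷_; _⁺++_; _++⁺_)
open import Function.Bundles using (_⇔_)
open import Level using (0ℓ)
open import Relation.Binary.Core using (Rel)
open import Relation.Binary.PropositionalEquality.Core using (_≡_)

-- Negation maps atoms to atoms.  No further property of atoms (decidable
-- equality, countability, a⁻ ≢ a) is assumed.
record Atoms : Set₁ where
  field
    Atom         : Set
    _⁻           : Atom → Atom
    ⁻-involutive : Involutive _≡_ _⁻

module _ (𝒜 : Atoms) where
  open Atoms 𝒜

  data Structure : Set where
    𝕗 𝕥  : Structure
    atom : Atom → Structure
    ⋁    : List⁺ Structure → Structure
    ⋀    : List⁺ Structure → Structure
    neg  : Structure → Structure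

module _ {𝒜 : Atoms} where

  -- [ R , T ] is disjunction and ⦅ R , T ⦆ is conjunction.
  [_,_] ⦅_,_⦆ : Structure 𝒜 → Structure 𝒜 → Structure 𝒜
  [ R , T ] = ⋁ (R ∷ T ∷ [])
  ⦅ R , T ⦆ = ⋀ (R ∷ T ∷ [])

-- There is no constructor for neg: the hole is never in the scope of a negation.
data Context (𝒜 : Atoms) : Set where
  □   : Context 𝒜
  ⋁[] : List (Structure 𝒜) → Context 𝒜 → List (Structure 𝒜) → Context 𝒜
  ⋀[] : List (Structure 𝒜) → Context 𝒜 → List (Structure 𝒜) → Context 𝒜

module _ {𝒜 : Atoms} where
  open Atoms 𝒜

  infix 15 _⟦_⟧
  infix 4 _≈_

  _⟦_⟧ : Context 𝒜 → Structure 𝒜 → Structure 𝒜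
  □          ⟦ R ⟧ = R
  ⋁[] Ts S Us ⟦ R ⟧ = ⋁ (Ts ++⁺ (S ⟦ R ⟧ ∷ Us))
  ⋀[] Ts S Us ⟦ R ⟧ = ⋀ (Ts ++⁺ (S ⟦ R ⟧ ∷ Us))

  data _≈_ : Rel (Structure 𝒜) 0ℓ where
    ≈-refl  : ∀ {R} → R ≈ R
    ≈-sym   : ∀ {R T} → R ≈ T → T ≈ R
    ≈-trans : ∀ {R T U} → R ≈ T → T ≈ U → R ≈ U

    ⋁-assoc : ∀ Rs Ts Us → ⋁ (Rs ++⁺ (⋁ Ts ∷ Us)) ≈ ⋁ (Rs ++⁺ (Ts ⁺++ Us))
    ⋀-assoc : ∀ Rs Ts Us → ⋀ (Rs ++⁺ (⋀ Ts ∷ Us)) ≈ ⋀ (Rs ++⁺ (Ts ⁺++ Us))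

    ⋁-comm : ∀ R T → [ R , T ] ≈ [ T , R ]
    ⋀-comm : ∀ R T → ⦅ R , T ⦆ ≈ ⦅ T , R ⦆

    ⋀-𝕗𝕗 : ⦅ 𝕗 , 𝕗 ⦆ ≈ 𝕗
    ⋁-𝕗  : ∀ R → [ 𝕗 , R ] ≈ R
    ⋁-𝕥𝕥 : [ 𝕥 , 𝕥 ] ≈ 𝕥
    ⋀-𝕥  : ∀ R → ⦅ 𝕥 , R ⦆ ≈ R

    neg-𝕗   : neg 𝕗 ≈ 𝕥
    neg-𝕥   : neg 𝕥 ≈ 𝕗
    neg-⋁   : ∀ R T → neg [ R , T ] ≈ ⦅ neg R , neg T ⦆
    neg-⋀   : ∀ R T → neg ⦅ R , T ⦆ ≈ [ neg R , neg T ]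
    neg-neg : ∀ R → neg (neg R) ≈ R
    -- The negation of an atom is again an atom: the formal negation of the
    -- structure a is identified with the atom a⁻.
    neg-atom : ∀ a → neg (atom a) ≈ atom (a ⁻)

    ≈-context : ∀ S {R T} → R ≈ T → S ⟦ R ⟧ ≈ S ⟦ T ⟧
    ≈-neg     : ∀ {R T} → R ≈ T → neg R ≈ neg T

-- A system is represented by the instances of its rules, as a relation from
-- premises to conclusions.
System : Atoms → Set₁
System 𝒜 = Rel (Structure 𝒜) 0ℓ

data SKSg (𝒜 : Atoms) : System 𝒜 where
  i↓ : ∀ S R     → SKSg 𝒜 (S ⟦ 𝕥 ⟧)                 (S ⟦ [ R , neg R ] ⟧)
  i↑ : ∀ S R     → SKSg 𝒜 (S ⟦ ⦅ R , neg R ⦆ ⟧)     (S ⟦ 𝕗 ⟧)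
  s  : ∀ S R T U → SKSg 𝒜 (S ⟦ ⦅ [ R , U ] , T ⦆ ⟧) (S ⟦ [ ⦅ R , T ⦆ , U ] ⟧)
  w↓ : ∀ S R     → SKSg 𝒜 (S ⟦ 𝕗 ⟧)                 (S ⟦ R ⟧)
  w↑ : ∀ S R     → SKSg 𝒜 (S ⟦ R ⟧)                 (S ⟦ 𝕥 ⟧)
  c↓ : ∀ S R     → SKSg 𝒜 (S ⟦ [ R , R ] ⟧)         (S ⟦ R ⟧)
  c↑ : ∀ S R     → SKSg 𝒜 (S ⟦ R ⟧)                 (S ⟦ ⦅ R , R ⦆ ⟧)

data SKS (𝒜 : Atoms) : System 𝒜 where
  ai↓ : ∀ S a       → SKS 𝒜 (S ⟦ 𝕥 ⟧)                           (S ⟦ [ atom a , neg (atom a) ] ⟧)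
  ai↑ : ∀ S a       → SKS 𝒜 (S ⟦ ⦅ atom a , neg (atom a) ⦆ ⟧)   (S ⟦ 𝕗 ⟧)
  s   : ∀ S R T U   → SKS 𝒜 (S ⟦ ⦅ [ R , U ] , T ⦆ ⟧)           (S ⟦ [ ⦅ R , T ⦆ , U ] ⟧)
  m   : ∀ S R T U V → SKS 𝒜 (S ⟦ [ ⦅ R , U ⦆ , ⦅ T , V ⦆ ] ⟧)   (S ⟦ ⦅ [ R , T ] , [ U , V ] ⦆ ⟧)
  aw↓ : ∀ S a       → SKS 𝒜 (S ⟦ 𝕗 ⟧)                           (S ⟦ atom a ⟧)
  aw↑ : ∀ S a       → SKS 𝒜 (S ⟦ atom a ⟧)                      (S ⟦ 𝕥 ⟧)
  ac↓ : ∀ S a       → SKS 𝒜 (S ⟦ [ atom a , atom a ] ⟧)         (S ⟦ atom a ⟧)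
  ac↑ : ∀ S a       → SKS 𝒜 (S ⟦ atom a ⟧)                      (S ⟦ ⦅ atom a , atom a ⦆ ⟧)

module _ {𝒜 : Atoms} where

  -- Derivation 𝒮 T R: derivations in 𝒮 with premise T and conclusion R.
  -- Equivalent structures are not distinguished, so consecutive structures
  -- (and the two ends of a derivation without rule instances) need only agree
  -- up to _≈_.
  data Derivation (𝒮 : System 𝒜) : Rel (Structure 𝒜) 0ℓ where
    single : ∀ {T R} → T ≈ R → Derivation 𝒮 T R
    step   : ∀ {T P Q R} → T ≈ P → 𝒮 P Q → Derivation 𝒮 Q R → Derivation 𝒮 T R

  StronglyEquivalent : System 𝒜 → System 𝒜 → Set
  StronglyEquivalent 𝒮 𝒮′ = ∀ T R → Derivation 𝒮 T R ⇔ Derivation 𝒮′ T R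

{-# OPTIONS --safe #-}

-- Up to _≈_ every structure is built from units and atoms by binary ⋁ and ⋀
-- only, since negations can be pushed to the atoms.  By induction on such a
-- form, switch reduces i↓ and i↑ to their atomic versions, medial does the same
-- for c↓ and c↑, and weakening splits along 𝕗 ≈ [ 𝕗 , 𝕗 ] ≈ ⦅ 𝕗 , 𝕗 ⦆, with
-- switch handling the step from 𝕗 to 𝕥.  Conversely, medial is a c↑ followed by
-- four w↑.

module Submission where

open import Algebra.Bundles using (CommutativeMonoid)
import Algebra.Properties.CommutativeSemigroup as CommutativeSemigroupProperties
open import Algebra.Structures.Biased using (isCommutativeMonoidˡ)
open import Data.List.Base using (List; []; _∷_)
open import Data.List.NonEmpty.Base using (_∷_; _++⁺_)
open import Data.List.Properties using (++-identityʳ)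
open import Function.Bundles using (mk⇔)
open import Level using (0ℓ)
open import Relation.Binary.Bundles using (Preorder)
open import Relation.Binary.Structures using (IsEquivalence)
open import Relation.Binary.PropositionalEquality.Core
  using (_≡_; refl; cong; subst; subst₂)
import Relation.Binary.Reasoning.Preorder as PreorderReasoning

open import Defs

module _ {𝒜 : Atoms} where

  -- Equivalence of structures as two commutative monoids

  ≈-isEquivalence : IsEquivalence (_≈_ {𝒜})
  ≈-isEquivalence = record { refl = ≈-refl ; sym = ≈-sym ; trans = ≈-trans }

  ⋁-cong : {R R′ T T′ : Structure 𝒜} → R ≈ R′ → T ≈ T′ → [ R , T ] ≈ [ R′ , T′ ]
  ⋁-cong {R′ = R′} {T = T} p q =
    ≈-trans (≈-context (⋁[] [] □ (T ∷ [])) p) (≈-context (⋁[] (R′ ∷ []) □ []) q)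

  ⋀-cong : {R R′ T T′ : Structure 𝒜} → R ≈ R′ → T ≈ T′ → ⦅ R , T ⦆ ≈ ⦅ R′ , T′ ⦆
  ⋀-cong {R′ = R′} {T = T} p q =
    ≈-trans (≈-context (⋀[] [] □ (T ∷ [])) p) (≈-context (⋀[] (R′ ∷ []) □ []) q)

  -- Packaging the equations this way provides the right unit law and the interchange law, both used
  -- in the derivations below.
  ⋁-commutativeMonoid : CommutativeMonoid 0ℓ 0ℓ
  ⋁-commutativeMonoid = record
    { Carrier             = Structure 𝒜
    ; isCommutativeMonoid = isCommutativeMonoidˡ record
      { isSemigroup = record
        { isMagma = record { isEquivalence = ≈-isEquivalence ; ∙-cong = ⋁-cong }
        -- Both bracketings flatten to the same ternary disjunction.
        ; assoc   = λ R T U → ≈-trans (⋁-assoc [] (R ∷ T ∷ []) (U ∷ []))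
                                      (≈-sym (⋁-assoc (R ∷ []) (T ∷ U ∷ []) []))
        }
      ; identityˡ = ⋁-𝕗
      ; comm      = ⋁-comm
      }
    }

  ⋀-commutativeMonoid : CommutativeMonoid 0ℓ 0ℓ
  ⋀-commutativeMonoid = record
    { Carrier             = Structure 𝒜
    ; isCommutativeMonoid = isCommutativeMonoidˡ record
      { isSemigroup = record
        { isMagma = record { isEquivalence = ≈-isEquivalence ; ∙-cong = ⋀-cong }
        ; assoc   = λ R T U → ≈-trans (⋀-assoc [] (R ∷ T ∷ []) (U ∷ []))
                                      (≈-sym (⋀-assoc (R ∷ []) (T ∷ U ∷ []) []))
        }
      ; identityˡ = ⋀-𝕥
      ; comm      = ⋀-comm
      }
    }

  module ⋁-Monoid = CommutativeMonoid ⋁-commutativeMonoid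
  module ⋀-Monoid = CommutativeMonoid ⋀-commutativeMonoid
  module ⋁-Props = CommutativeSemigroupProperties ⋁-Monoid.commutativeSemigroup
  module ⋀-Props = CommutativeSemigroupProperties ⋀-Monoid.commutativeSemigroup

  -- Associativity flattens only a disjunction nested in another one, so the unit `𝕗` is first put
  -- beside it and dropped again after flattening.
  ⋁-singleton : (R : Structure 𝒜) → ⋁ (R ∷ []) ≈ R
  ⋁-singleton R = ≈-trans (≈-sym (⋁-𝕗 _)) (≈-trans (⋁-assoc (𝕗 ∷ []) (R ∷ []) []) (⋁-𝕗 R))

  ⋀-singleton : (R : Structure 𝒜) → ⋀ (R ∷ []) ≈ R
  ⋀-singleton R = ≈-trans (≈-sym (⋀-𝕥 _)) (≈-trans (⋀-assoc (𝕥 ∷ []) (R ∷ []) []) (⋀-𝕥 R))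

  ⋁-∷ : (R T : Structure 𝒜) (Us : List (Structure 𝒜)) →
        [ R , ⋁ (T ∷ Us) ] ≈ ⋁ (R ∷ T ∷ Us)
  -- Flattening with nothing to the right leaves a trailing `++ []`, which the transport removes.
  ⋁-∷ R T Us = subst (λ Us′ → [ R , ⋁ (T ∷ Us) ] ≈ ⋁ (R ∷ T ∷ Us′))
                     (++-identityʳ Us) (⋁-assoc (R ∷ []) (T ∷ Us) [])

  ⋀-∷ : (R T : Structure 𝒜) (Us : List (Structure 𝒜)) →
        ⦅ R , ⋀ (T ∷ Us) ⦆ ≈ ⋀ (R ∷ T ∷ Us)
  ⋀-∷ R T Us = subst (λ Us′ → ⦅ R , ⋀ (T ∷ Us) ⦆ ≈ ⋀ (R ∷ T ∷ Us′))
                     (++-identityʳ Us) (⋀-assoc (R ∷ []) (T ∷ Us) [])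

  -- Binary negation normal forms

  -- The structures that are equivalent to a binary negation normal form.
  data Normalisable : Structure 𝒜 → Set where
    𝕗    : Normalisable 𝕗
    𝕥    : Normalisable 𝕥
    atom : ∀ a → Normalisable (atom a)
    or   : ∀ {R T} → Normalisable R → Normalisable T → Normalisable [ R , T ]
    and  : ∀ {R T} → Normalisable R → Normalisable T → Normalisable ⦅ R , T ⦆
    resp : ∀ {R T} → R ≈ T → Normalisable R → Normalisable T

  -- The De Morgan equations cover only binary connectives, so the recursion follows the
  -- normalisability proof instead of the structure, whose lists have arbitrary length.
  normalisable-neg : ∀ {R} → Normalisable R → Normalisable (neg R)
  normalisable-neg 𝕗          = resp (≈-sym neg-𝕗) 𝕥
  normalisable-neg 𝕥          = resp (≈-sym neg-𝕥) 𝕗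
  normalisable-neg (atom a)   = resp (≈-sym (neg-atom a)) (atom _)
  normalisable-neg (or r t)   =
    resp (≈-sym (neg-⋁ _ _)) (and (normalisable-neg r) (normalisable-neg t))
  normalisable-neg (and r t)  =
    resp (≈-sym (neg-⋀ _ _)) (or (normalisable-neg r) (normalisable-neg t))
  normalisable-neg (resp p r) = resp (≈-neg p) (normalisable-neg r)

  mutual
    normalisable : ∀ R → Normalisable R
    normalisable 𝕗            = 𝕗
    normalisable 𝕥            = 𝕥
    normalisable (atom a)     = atom a
    normalisable (⋁ (R ∷ Rs)) = normalisable-⋁ R Rs
    normalisable (⋀ (R ∷ Rs)) = normalisable-⋀ R Rs
    normalisable (neg R)      = normalisable-neg (normalisable R)

    normalisable-⋁ : ∀ R Rs → Normalisable (⋁ (R ∷ Rs))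
    normalisable-⋁ R []       = resp (≈-sym (⋁-singleton R)) (normalisable R)
    normalisable-⋁ R (T ∷ Us) = resp (⋁-∷ R T Us) (or (normalisable R) (normalisable-⋁ T Us))

    normalisable-⋀ : ∀ R Rs → Normalisable (⋀ (R ∷ Rs))
    normalisable-⋀ R []       = resp (≈-sym (⋀-singleton R)) (normalisable R)
    normalisable-⋀ R (T ∷ Us) = resp (⋀-∷ R T Us) (and (normalisable R) (normalisable-⋀ T Us))

  -- Composition of contexts and derivability inside contexts

  infixr 9 _⊙_

  _⊙_ : Context 𝒜 → Context 𝒜 → Context 𝒜
  □           ⊙ S′ = S′
  ⋁[] Ts S Us ⊙ S′ = ⋁[] Ts (S ⊙ S′) Us
  ⋀[] Ts S Us ⊙ S′ = ⋀[] Ts (S ⊙ S′) Us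

  ⊙-⟦⟧ : ∀ S S′ R → (S ⊙ S′) ⟦ R ⟧ ≡ S ⟦ S′ ⟦ R ⟧ ⟧
  ⊙-⟦⟧ □             S′ R = refl
  ⊙-⟦⟧ (⋁[] Ts S Us) S′ R = cong (λ T → ⋁ (Ts ++⁺ (T ∷ Us))) (⊙-⟦⟧ S S′ R)
  ⊙-⟦⟧ (⋀[] Ts S Us) S′ R = cong (λ T → ⋀ (Ts ++⁺ (T ∷ Us))) (⊙-⟦⟧ S S′ R)

  module Derivability (𝒮 : System 𝒜) where

    infixr 5 _++ᵈ_
    infix 4 _⟶_

    ≈-++ᵈ : ∀ {T P R} → T ≈ P → Derivation 𝒮 P R → Derivation 𝒮 T R
    ≈-++ᵈ p (single q)   = single (≈-trans p q)
    ≈-++ᵈ p (step q ρ δ) = step (≈-trans p q) ρ δ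

    _++ᵈ_ : ∀ {T P R} → Derivation 𝒮 T P → Derivation 𝒮 P R → Derivation 𝒮 T R
    single p   ++ᵈ ε = ≈-++ᵈ p ε
    step p ρ δ ++ᵈ ε = step p ρ (δ ++ᵈ ε)

    -- Quantifying over the surrounding context builds in closure under contexts.
    record _⟶_ (T R : Structure 𝒜) : Set where
      constructor in-context
      field _at_ : ∀ S → Derivation 𝒮 (S ⟦ T ⟧) (S ⟦ R ⟧)

    open _⟶_ public

    rule : ∀ {T R} → (∀ S → 𝒮 (S ⟦ T ⟧) (S ⟦ R ⟧)) → T ⟶ R
    rule ρ = in-context λ S → step ≈-refl (ρ S) (single ≈-refl)

    ⟶-preorder : Preorder 0ℓ 0ℓ 0ℓ
    ⟶-preorder = record
      { _≈_        = _≈_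
      ; _≲_        = _⟶_
      ; isPreorder = record
        { isEquivalence = ≈-isEquivalence
        ; reflexive     = λ p → in-context λ S → single (≈-context S p)
        ; trans         = λ δ ε → in-context λ S → (δ at S) ++ᵈ (ε at S)
        }
      }

    module ⟶-Reasoning = PreorderReasoning ⟶-preorder

    -- A derivation is available in every surrounding context, in particular in the composite
    -- `S′ ⊙ S`; the transport splits that filling into two.
    ⟶-context : ∀ S {T R} → T ⟶ R → S ⟦ T ⟧ ⟶ S ⟦ R ⟧
    ⟶-context S {T} {R} δ = in-context λ S′ →
      subst₂ (Derivation 𝒮) (⊙-⟦⟧ S′ S T) (⊙-⟦⟧ S′ S R) (δ at (S′ ⊙ S))

    ⋁-mono : ∀ {R R′ T T′} → R ⟶ R′ → T ⟶ T′ → [ R , T ] ⟶ [ R′ , T′ ]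
    ⋁-mono {R′ = R′} {T = T} δ ε = Preorder.trans ⟶-preorder
      (⟶-context (⋁[] [] □ (T ∷ [])) δ) (⟶-context (⋁[] (R′ ∷ []) □ []) ε)

    ⋀-mono : ∀ {R R′ T T′} → R ⟶ R′ → T ⟶ T′ → ⦅ R , T ⦆ ⟶ ⦅ R′ , T′ ⦆
    ⋀-mono {R′ = R′} {T = T} δ ε = Preorder.trans ⟶-preorder
      (⟶-context (⋀[] [] □ (T ∷ [])) δ) (⟶-context (⋀[] (R′ ∷ []) □ []) ε)

  translate : ∀ {𝒮 𝒮′ : System 𝒜} → (∀ {P Q} → 𝒮 P Q → Derivation 𝒮′ P Q) →
              ∀ {T R} → Derivation 𝒮 T R → Derivation 𝒮′ T R
  translate f (single p) = single p
  translate {𝒮′ = 𝒮′} f (step p ρ δ) = ≈-++ᵈ p (f ρ ++ᵈ translate f δ)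
    where open Derivability 𝒮′

  -- Simulating the atomic system in the general one

  module InSKSg where
    open Derivability (SKSg 𝒜)
    open ⟶-Reasoning

    weaken : ∀ R → R ⟶ 𝕥
    weaken R = rule λ S → w↑ S R

    project₁ : ∀ R T → ⦅ R , T ⦆ ⟶ R
    project₁ R T = begin
      ⦅ R , T ⦆ ≲⟨ ⋀-mono (Preorder.refl ⟶-preorder) (weaken T) ⟩
      ⦅ R , 𝕥 ⦆ ≈⟨ ⋀-Monoid.identityʳ R ⟩
      R         ∎

    project₂ : ∀ R T → ⦅ R , T ⦆ ⟶ T
    project₂ R T = begin
      ⦅ R , T ⦆ ≈⟨ ⋀-comm R T ⟩
      ⦅ T , R ⦆ ≲⟨ project₁ T R ⟩
      T         ∎

    medial : ∀ R T U V → [ ⦅ R , U ⦆ , ⦅ T , V ⦆ ] ⟶ ⦅ [ R , T ] , [ U , V ] ⦆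
    medial R T U V = begin
      [ ⦅ R , U ⦆ , ⦅ T , V ⦆ ]
        ≲⟨ rule (λ S → c↑ S _) ⟩
      ⦅ [ ⦅ R , U ⦆ , ⦅ T , V ⦆ ] , [ ⦅ R , U ⦆ , ⦅ T , V ⦆ ] ⦆
        -- The first copy keeps the left conjunct of each disjunct, the second copy the right one.
        ≲⟨ ⋀-mono (⋁-mono (project₁ R U) (project₁ T V))
                  (⋁-mono (project₂ R U) (project₂ T V)) ⟩
      ⦅ [ R , T ] , [ U , V ] ⦆ ∎

    simulate : ∀ {P Q} → SKS 𝒜 P Q → Derivation (SKSg 𝒜) P Q
    simulate (ai↓ S a)     = rule (λ S → i↓ S (atom a)) at S
    simulate (ai↑ S a)     = rule (λ S → i↑ S (atom a)) at S
    simulate (s S R T U)   = rule (λ S → s S R T U) at S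
    simulate (m S R T U V) = medial R T U V at S
    simulate (aw↓ S a)     = rule (λ S → w↓ S (atom a)) at S
    simulate (aw↑ S a)     = weaken (atom a) at S
    simulate (ac↓ S a)     = rule (λ S → c↓ S (atom a)) at S
    simulate (ac↑ S a)     = rule (λ S → c↑ S (atom a)) at S

  -- Reducing the general rules to atomic ones

  module InSKS where
    open Derivability (SKS 𝒜)
    open ⟶-Reasoning

    ≈⇒⟶ : ∀ {T R} → T ≈ R → T ⟶ R
    ≈⇒⟶ = Preorder.reflexive ⟶-preorder

    switch : ∀ R T U → ⦅ [ R , U ] , T ⦆ ⟶ [ ⦅ R , T ⦆ , U ]
    switch R T U = rule λ S → s S R T U

    medial : ∀ R T U V → [ ⦅ R , U ⦆ , ⦅ T , V ⦆ ] ⟶ ⦅ [ R , T ] , [ U , V ] ⦆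
    medial R T U V = rule λ S → m S R T U V

    -- For `identity`: one switch moves `U` out of the conjunction, a second one moves `V` out.
    switch-⋁⋁ : ∀ R U T V → ⦅ [ R , U ] , [ T , V ] ⦆ ⟶ [ ⦅ R , T ⦆ , [ U , V ] ]
    switch-⋁⋁ R U T V = begin
      ⦅ [ R , U ] , [ T , V ] ⦆   ≲⟨ switch R [ T , V ] U ⟩
      [ ⦅ R , [ T , V ] ⦆ , U ]   ≈⟨ ⋁-cong (⋀-comm _ _) ≈-refl ⟩
      [ ⦅ [ T , V ] , R ⦆ , U ]   ≲⟨ ⋁-mono (switch T R V) (≈⇒⟶ ≈-refl) ⟩
      [ [ ⦅ T , R ⦆ , V ] , U ]   ≈⟨ ⋁-Monoid.assoc _ _ _ ⟩
      [ ⦅ T , R ⦆ , [ V , U ] ]   ≈⟨ ⋁-cong (⋀-comm T R) (⋁-comm V U) ⟩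
      [ ⦅ R , T ⦆ , [ U , V ] ]   ∎

    -- The dual, for `cut`: one switch attaches `U` to `R`, a second one attaches `V` to `T`.
    switch-⋁⋀ : ∀ R T U V → ⦅ [ R , T ] , ⦅ U , V ⦆ ⦆ ⟶ [ ⦅ R , U ⦆ , ⦅ T , V ⦆ ]
    switch-⋁⋀ R T U V = begin
      ⦅ [ R , T ] , ⦅ U , V ⦆ ⦆   ≈⟨ ⋀-Monoid.assoc _ _ _ ⟨
      ⦅ ⦅ [ R , T ] , U ⦆ , V ⦆   ≲⟨ ⋀-mono (switch R U T) (≈⇒⟶ ≈-refl) ⟩
      ⦅ [ ⦅ R , U ⦆ , T ] , V ⦆   ≈⟨ ⋀-cong (⋁-comm _ _) ≈-refl ⟩
      ⦅ [ T , ⦅ R , U ⦆ ] , V ⦆   ≲⟨ switch T V ⦅ R , U ⦆ ⟩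
      [ ⦅ T , V ⦆ , ⦅ R , U ⦆ ]   ≈⟨ ⋁-comm _ _ ⟩
      [ ⦅ R , U ⦆ , ⦅ T , V ⦆ ]   ∎

    𝕗⟶𝕥 : 𝕗 ⟶ 𝕥
    𝕗⟶𝕥 = begin
      𝕗                   ≈⟨ ⋀-𝕥 𝕗 ⟨
      -- Doubling `𝕥` lets the switch attach `𝕗` to one copy, where the conjunction collapses to
      -- `𝕗`, the unit of disjunction; the other copy survives.
      ⦅ 𝕥 , 𝕗 ⦆           ≈⟨ ⋀-cong ⋁-𝕥𝕥 ≈-refl ⟨
      ⦅ [ 𝕥 , 𝕥 ] , 𝕗 ⦆   ≲⟨ switch 𝕥 𝕗 𝕥 ⟩
      [ ⦅ 𝕥 , 𝕗 ⦆ , 𝕥 ]   ≈⟨ ⋁-cong (⋀-𝕥 𝕗) ≈-refl ⟩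
      [ 𝕗 , 𝕥 ]           ≈⟨ ⋁-𝕗 𝕥 ⟩
      𝕥                   ∎

    weakening : ∀ {R} → Normalisable R → 𝕗 ⟶ R
    weakening 𝕗                  = ≈⇒⟶ ≈-refl
    weakening 𝕥                  = 𝕗⟶𝕥
    weakening (atom a)           = rule λ S → aw↓ S a
    weakening (or {R} {T} r t)   = begin
      𝕗         ≈⟨ ⋁-𝕗 𝕗 ⟨
      [ 𝕗 , 𝕗 ] ≲⟨ ⋁-mono (weakening r) (weakening t) ⟩
      [ R , T ] ∎
    weakening (and {R} {T} r t)  = begin
      𝕗         ≈⟨ ⋀-𝕗𝕗 ⟨
      ⦅ 𝕗 , 𝕗 ⦆ ≲⟨ ⋀-mono (weakening r) (weakening t) ⟩
      ⦅ R , T ⦆ ∎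
    weakening (resp {R} {T} p r) = begin
      𝕗 ≲⟨ weakening r ⟩
      R ≈⟨ p ⟩
      T ∎

    -- Mirror image of `weakening`, with the two units exchanged: `[ 𝕥 , 𝕥 ] ≈ 𝕥` now takes the
    -- place of `⦅ 𝕗 , 𝕗 ⦆ ≈ 𝕗`.
    coweakening : ∀ {R} → Normalisable R → R ⟶ 𝕥
    coweakening 𝕗                  = 𝕗⟶𝕥
    coweakening 𝕥                  = ≈⇒⟶ ≈-refl
    coweakening (atom a)           = rule λ S → aw↑ S a
    coweakening (or {R} {T} r t)   = begin
      [ R , T ] ≲⟨ ⋁-mono (coweakening r) (coweakening t) ⟩
      [ 𝕥 , 𝕥 ] ≈⟨ ⋁-𝕥𝕥 ⟩
      𝕥         ∎
    coweakening (and {R} {T} r t)  = begin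
      ⦅ R , T ⦆ ≲⟨ ⋀-mono (coweakening r) (coweakening t) ⟩
      ⦅ 𝕥 , 𝕥 ⦆ ≈⟨ ⋀-𝕥 𝕥 ⟩
      𝕥         ∎
    coweakening (resp {R} {T} p r) = begin
      T ≈⟨ p ⟨
      R ≲⟨ coweakening r ⟩
      𝕥 ∎

    -- In a disjunction the copies can be regrouped by equivalence alone; only a conjunction calls
    -- for medial.
    contraction : ∀ {R} → Normalisable R → [ R , R ] ⟶ R
    contraction 𝕗                  = ≈⇒⟶ (⋁-𝕗 𝕗)
    contraction 𝕥                  = ≈⇒⟶ ⋁-𝕥𝕥
    contraction (atom a)           = rule λ S → ac↓ S a
    contraction (or {R} {T} r t)   = begin
      [ [ R , T ] , [ R , T ] ] ≈⟨ ⋁-Props.interchange R T R T ⟩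
      [ [ R , R ] , [ T , T ] ] ≲⟨ ⋁-mono (contraction r) (contraction t) ⟩
      [ R , T ]                 ∎
    contraction (and {R} {T} r t)  = begin
      [ ⦅ R , T ⦆ , ⦅ R , T ⦆ ] ≲⟨ medial R R T T ⟩
      ⦅ [ R , R ] , [ T , T ] ⦆ ≲⟨ ⋀-mono (contraction r) (contraction t) ⟩
      ⦅ R , T ⦆                 ∎
    contraction (resp {R} {T} p r) = begin
      [ T , T ] ≈⟨ ⋁-cong p p ⟨
      [ R , R ] ≲⟨ contraction r ⟩
      R         ≈⟨ p ⟩
      T         ∎

    -- The roles are swapped here: conjunctions regroup by equivalence, and medial serves the
    -- disjunctions.
    cocontraction : ∀ {R} → Normalisable R → R ⟶ ⦅ R , R ⦆
    cocontraction 𝕗                  = ≈⇒⟶ (≈-sym ⋀-𝕗𝕗)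
    cocontraction 𝕥                  = ≈⇒⟶ (≈-sym (⋀-𝕥 𝕥))
    cocontraction (atom a)           = rule λ S → ac↑ S a
    cocontraction (or {R} {T} r t)   = begin
      [ R , T ]                 ≲⟨ ⋁-mono (cocontraction r) (cocontraction t) ⟩
      [ ⦅ R , R ⦆ , ⦅ T , T ⦆ ] ≲⟨ medial R T R T ⟩
      ⦅ [ R , T ] , [ R , T ] ⦆ ∎
    cocontraction (and {R} {T} r t)  = begin
      ⦅ R , T ⦆                 ≲⟨ ⋀-mono (cocontraction r) (cocontraction t) ⟩
      ⦅ ⦅ R , R ⦆ , ⦅ T , T ⦆ ⦆ ≈⟨ ⋀-Props.interchange R R T T ⟩
      ⦅ ⦅ R , T ⦆ , ⦅ R , T ⦆ ⦆ ∎
    cocontraction (resp {R} {T} p r) = begin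
      T         ≈⟨ p ⟨
      R         ≲⟨ cocontraction r ⟩
      ⦅ R , R ⦆ ≈⟨ ⋀-cong p p ⟩
      ⦅ T , T ⦆ ∎

    identity : ∀ {R} → Normalisable R → 𝕥 ⟶ [ R , neg R ]
    identity 𝕗                  = ≈⇒⟶ (≈-sym (≈-trans (⋁-𝕗 _) neg-𝕗))
    identity 𝕥                  = ≈⇒⟶ (≈-sym (≈-trans (⋁-cong ≈-refl neg-𝕥) (⋁-Monoid.identityʳ 𝕥)))
    identity (atom a)           = rule λ S → ai↓ S a
    identity (or {R} {T} r t)   = begin
      𝕥                                 ≈⟨ ⋀-𝕥 𝕥 ⟨
      ⦅ 𝕥 , 𝕥 ⦆                         ≲⟨ ⋀-mono (identity r) (identity t) ⟩
      -- The negations come first because `switch-⋁⋁` conjoins the left disjuncts, and it is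
      -- `⦅ neg R , neg T ⦆` that De Morgan folds into a negation.
      ⦅ [ R , neg R ] , [ T , neg T ] ⦆ ≈⟨ ⋀-cong (⋁-comm _ _) (⋁-comm _ _) ⟩
      ⦅ [ neg R , R ] , [ neg T , T ] ⦆ ≲⟨ switch-⋁⋁ (neg R) R (neg T) T ⟩
      [ ⦅ neg R , neg T ⦆ , [ R , T ] ] ≈⟨ ⋁-cong (neg-⋁ R T) ≈-refl ⟨
      [ neg [ R , T ] , [ R , T ] ]     ≈⟨ ⋁-comm _ _ ⟩
      [ [ R , T ] , neg [ R , T ] ]     ∎
    identity (and {R} {T} r t)  = begin
      𝕥                                 ≈⟨ ⋀-𝕥 𝕥 ⟨
      ⦅ 𝕥 , 𝕥 ⦆                         ≲⟨ ⋀-mono (identity r) (identity t) ⟩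
      ⦅ [ R , neg R ] , [ T , neg T ] ⦆ ≲⟨ switch-⋁⋁ R (neg R) T (neg T) ⟩
      [ ⦅ R , T ⦆ , [ neg R , neg T ] ] ≈⟨ ⋁-cong ≈-refl (neg-⋀ R T) ⟨
      [ ⦅ R , T ⦆ , neg ⦅ R , T ⦆ ]     ∎
    identity (resp {R} {T} p r) = begin
      𝕥             ≲⟨ identity r ⟩
      [ R , neg R ] ≈⟨ ⋁-cong p (≈-neg p) ⟩
      [ T , neg T ] ∎

    cut : ∀ {R} → Normalisable R → ⦅ R , neg R ⦆ ⟶ 𝕗
    cut 𝕗                  = ≈⇒⟶ (≈-trans (⋀-cong ≈-refl neg-𝕗) (⋀-Monoid.identityʳ 𝕗))
    cut 𝕥                  = ≈⇒⟶ (≈-trans (⋀-𝕥 _) neg-𝕥)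
    cut (atom a)           = rule λ S → ai↑ S a
    cut (or {R} {T} r t)   = begin
      ⦅ [ R , T ] , neg [ R , T ] ⦆     ≈⟨ ⋀-cong ≈-refl (neg-⋁ R T) ⟩
      ⦅ [ R , T ] , ⦅ neg R , neg T ⦆ ⦆ ≲⟨ switch-⋁⋀ R T (neg R) (neg T) ⟩
      [ ⦅ R , neg R ⦆ , ⦅ T , neg T ⦆ ] ≲⟨ ⋁-mono (cut r) (cut t) ⟩
      [ 𝕗 , 𝕗 ]                         ≈⟨ ⋁-𝕗 𝕗 ⟩
      𝕗                                 ∎
    cut (and {R} {T} r t)  = begin
      -- Here the disjunction arises from the negated side, so that side is moved to the left, where
      -- `switch-⋁⋀` expects it.
      ⦅ ⦅ R , T ⦆ , neg ⦅ R , T ⦆ ⦆     ≈⟨ ⋀-comm _ _ ⟩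
      ⦅ neg ⦅ R , T ⦆ , ⦅ R , T ⦆ ⦆     ≈⟨ ⋀-cong (neg-⋀ R T) ≈-refl ⟩
      ⦅ [ neg R , neg T ] , ⦅ R , T ⦆ ⦆ ≲⟨ switch-⋁⋀ (neg R) (neg T) R T ⟩
      [ ⦅ neg R , R ⦆ , ⦅ neg T , T ⦆ ] ≈⟨ ⋁-cong (⋀-comm _ _) (⋀-comm _ _) ⟩
      [ ⦅ R , neg R ⦆ , ⦅ T , neg T ⦆ ] ≲⟨ ⋁-mono (cut r) (cut t) ⟩
      [ 𝕗 , 𝕗 ]                         ≈⟨ ⋁-𝕗 𝕗 ⟩
      𝕗                                 ∎
    cut (resp {R} {T} p r) = begin
      ⦅ T , neg T ⦆ ≈⟨ ⋀-cong p (≈-neg p) ⟨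
      ⦅ R , neg R ⦆ ≲⟨ cut r ⟩
      𝕗             ∎

    simulate : ∀ {P Q} → SKSg 𝒜 P Q → Derivation (SKS 𝒜) P Q
    simulate (i↓ S R)    = identity (normalisable R) at S
    simulate (i↑ S R)    = cut (normalisable R) at S
    simulate (s S R T U) = switch R T U at S
    simulate (w↓ S R)    = weakening (normalisable R) at S
    simulate (w↑ S R)    = coweakening (normalisable R) at S
    simulate (c↓ S R)    = contraction (normalisable R) at S
    simulate (c↑ S R)    = cocontraction (normalisable R) at S

theorem3p24 : (𝒜 : Atoms) → StronglyEquivalent (SKS 𝒜) (SKSg 𝒜)
theorem3p24 𝒜 T R = mk⇔ (translate InSKSg.simulate) (translate InSKS.simulate)
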